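{- Let $\mathbf{B}$ be a 2-element algebra with universe $\{0,1\}$ such that at least one of the following holds: (1) $\mathbf{B}\preceq\boldsymbol{\bigwedge}$, (2) $\mathbf{B}\preceq\boldsymbol{\bigvee}$, or (3) $\mathbf{B}\preceq\mathsf{A}$. Let $\mathbf{A}=\mathbf{B}^n$. Then any classical algorithm which solves $\mathrm{HKP}(\mathbf{A})$ must make $\Omega(2^{n/2})$ queries to the oracle.
   Context: $\mathrm{Clo}(\mathbf{B})$ is the clone of term operations of $\mathbf{B}$ (smallest set of operations on $\{0,1\}$ containing the basic operations and projections, closed under composition). For a clone $\mathcal{C}$ on $\{0,1\}$, $\mathbf{B}\preceq\mathcal{C}$ means $\mathrm{Clo}(\mathbf{B})\subseteq\mathcal{C}$. $\boldsymbol{\bigwedge}$ is the clone generated by $x\wedge y$ and the constants $0,1$; $\boldsymbol{\bigvee}$ is the clone generated by $x\vee y$ and the constants $0,1$; $\mathsf{A}$ is the clone generated by $x\leftrightarrow y$ (the operation equal to $1$ iff $x=y$) and the constant $0$. $\mathbf{B}^n$ is the direct power with coordinatewise operations. A congruence is an equivalence relation compatible with all operations; $\ker(\phi)=\{(a,b):\phi(a)=\phi(b)\}$. The Hidden Kernel Problem $\mathrm{HKP}(\mathbf{A})$: given a similar algebra $\mathbf{C}$ and a homomorphism $\phi:\mathbf{A}\to\mathbf{C}$ accessible only as an oracle, determine the congruence $\ker(\phi)$. -}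

module Defs where

open import Data.Bool.Base using (Bool; true; false; _∧_; _∨_; T)
open import Data.Bool.Properties using (_≟_)
open import Data.Fin.Base using (Fin)
open import Data.Fin.Subset using (Subset; ∣_∣; _∈_)
open import Data.Nat.Base using (ℕ; suc; _*_; _≤_; NonZero)
open import Data.Product using (∃-syntax; _×_)
open import Data.Vec.Base using (Vec; []; _∷_; lookup; map; tabulate)
open import Function.Bundles using (_⇔_)
open import Level using (0ℓ)
open import Relation.Binary.Core using (Rel)
open import Relation.Binary.Definitions using (DecidableEquality)
open import Relation.Binary.PropositionalEquality using (_≡_; _≗_)
open import Relation.Nullary.Decidable using (does)
open import Relation.Unary using (Pred; _⊆_)

------------------------------------------------------------------------
-- Algebras

Op : ℕ → Set → Set
Op k X = Vec X k → X

record Signature : Set₁ where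
  field
    Symbol : Set
    arity  : Symbol → ℕ

open Signature public

Interpretation : Signature → Set → Set
Interpretation S X = (o : Symbol S) → Op (arity S o) X

record Algebra (S : Signature) : Set₁ where
  field
    Carrier : Set
    interp  : Interpretation S Carrier

open Algebra public

record Hom {S : Signature} (𝐀 𝐂 : Algebra S) : Set where
  field
    fun   : Carrier 𝐀 → Carrier 𝐂
    isHom : ∀ o xs → fun (interp 𝐀 o xs) ≡ interp 𝐂 o (map fun xs)

open Hom public

ker : {X Y : Set} → (X → Y) → Rel X 0ℓ
ker φ a b = φ a ≡ φ b

Power : {S : Signature} {X : Set} → Interpretation S X → ℕ → Algebra S
Power {X = X} B n = record
  { Carrier = Vec X n
  ; interp  = λ o xs → tabulate λ i → B o (map (λ x → lookup x i) xs)
  }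

------------------------------------------------------------------------
-- Clones

OpSet : Set → Set₁
OpSet X = ∀ k → Pred (Op k X) 0ℓ

-- Operations are Agda functions, so the set has to be closed under pointwise
-- equality explicitly (`ext`) for its members to be operations in the
-- extensional sense.  Nullary operations are allowed.
data Clo {S : Signature} {X : Set} (B : Interpretation S X) : OpSet X where
  basic : ∀ o → Clo B (arity S o) (B o)
  proj  : ∀ {k} (i : Fin k) → Clo B k (λ xs → lookup xs i)
  comp  : ∀ {k m} {f : Op k X} {gs : Fin k → Op m X} →
          Clo B k f → (∀ i → Clo B m (gs i)) →
          Clo B m (λ xs → f (tabulate λ i → gs i xs))
  ext   : ∀ {k} {f g : Op k X} → f ≗ g → Clo B k f → Clo B k g

infix 4 _⪯_

_⪯_ : {S : Signature} {X : Set} → Interpretation S X → OpSet X → Set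
B ⪯ 𝒞 = ∀ k → Clo B k ⊆ 𝒞 k

-- The three clones on {0,1}, with 0 = false and 1 = true.

data BoundedSymbol : Set where
  binary zero one : BoundedSymbol

boundedSignature : Signature
boundedSignature = record
  { Symbol = BoundedSymbol
  ; arity  = λ { binary → 2 ; zero → 0 ; one → 0 }
  }

bounded : (Bool → Bool → Bool) → Interpretation boundedSignature Bool
bounded _·_ binary (x ∷ y ∷ []) = x · y
bounded _·_ zero   []           = false
bounded _·_ one    []           = true

data AffineSymbol : Set where
  iff zero : AffineSymbol

affineSignature : Signature
affineSignature = record
  { Symbol = AffineSymbol
  ; arity  = λ { iff → 2 ; zero → 0 }
  }

affine : Interpretation affineSignature Bool
affine iff  (x ∷ y ∷ []) = does (x ≟ y)
affine zero []           = false

⋀ ⋁ 𝖠 : OpSet Bool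
⋀ = Clo (bounded _∧_)
⋁ = Clo (bounded _∨_)
𝖠 = Clo affine

------------------------------------------------------------------------
-- Classical query algorithms

-- A deterministic algorithm with an oracle X → Y and result in Z: queries are
-- adaptive, and computation between queries is unrestricted and free.
data DecisionTree (X Y Z : Set) : Set where
  output : Z → DecisionTree X Y Z
  query  : X → (Y → DecisionTree X Y Z) → DecisionTree X Y Z

module _ {X Y Z : Set} (φ : X → Y) where

  run : DecisionTree X Y Z → Z
  run (output z)  = z
  run (query x t) = run (t (φ x))

  queries : DecisionTree X Y Z → ℕ
  queries (output z)  = 0
  queries (query x t) = suc (queries (t (φ x)))

-- A seed is drawn uniformly at random before the first query; one seed gives
-- the deterministic algorithms.
record RandomizedAlgorithm (X Y Z : Set) : Set where
  field
    seeds   : ℕ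
    nonZero : NonZero seeds
    tree    : Fin seeds → DecisionTree X Y Z

open RandomizedAlgorithm public

-- P holds for at least two thirds of the n equally likely outcomes.
Prob≥2/3 : {n : ℕ} → Pred (Fin n) 0ℓ → Set
Prob≥2/3 {n} P = ∃[ G ] (2 * n ≤ 3 * ∣ G ∣ × (∀ {r} → r ∈ G → P r))

------------------------------------------------------------------------
-- The hidden kernel problem

module HKP {S : Signature} (𝐀 : Algebra S) where

  A : Set
  A = Carrier 𝐀

  -- The algorithm may depend on the universe of 𝐂, whose elements it can
  -- compare for equality, but everything else about 𝐂 and φ, including the
  -- operations of 𝐂, is hidden behind the oracle.  (Were the operations of 𝐂
  -- known, φ could be computed from its values on a generating set of 𝐀.)
  -- The result is a Boolean-valued relation, meant to be ker φ.
  Algorithm : Set₁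
  Algorithm = (Y : Set) → DecidableEquality Y →
              RandomizedAlgorithm A Y (A → A → Bool)

  IsKernel : {Y : Set} → (A → Y) → (A → A → Bool) → Set
  IsKernel φ θ = ∀ a b → T (θ a b) ⇔ ker φ a b

  Solves : Algorithm → Set₁
  Solves M = (𝐂 : Algebra S) (_≟C_ : DecidableEquality (Carrier 𝐂))
             (φ : Hom 𝐀 𝐂) →
             Prob≥2/3 λ r →
               IsKernel (fun φ) (run (fun φ) (tree (M (Carrier 𝐂) _≟C_) r))

  -- Worst case over all instances and all random seeds.
  MakesAtMost : Algorithm → ℕ → Set₁
  MakesAtMost M q = (𝐂 : Algebra S) (_≟C_ : DecidableEquality (Carrier 𝐂))
                    (φ : Hom 𝐀 𝐂) (r : Fin (seeds (M (Carrier 𝐂) _≟C_))) →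
                    queries (fun φ) (tree (M (Carrier 𝐂) _≟C_) r) ≤ q

{-# OPTIONS --safe #-}
module Submission where

-- Both kinds of algebra hide exponentially many kernels, and a random instance defeats every
-- decision tree; averaging over the instances then defeats a random choice of trees.
--
-- Below ∧ (dually ∨), the Rees congruence collapsing an ideal of {0,1}ⁿ is a congruence.  Let the
-- ideal consist of all sets with fewer than ⌊n/2⌋ elements and one further set a from an antichain
-- of 2^⌊n/2⌋ sets of size ⌊n/2⌋.  Only the query a distinguishes this from the ideal without a, so
-- finding a is unstructured search.
--
-- Below 𝖠, the cosets of {0, s} form a congruence for every s, and finding s is Simon's problem.
-- Label the cosets by a random injection.  As long as no two queries differ by s, the answers are
-- distributed as for s = 0, and the (k+1)-st query excludes at most k values of s, so
-- Ω(2^(n/2)) queries are needed to exclude a constant fraction of them.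

open import Defs
open import Data.Bool.Base using (Bool; true; false; not; _∧_; _∨_; _xor_; if_then_else_; T)
import Data.Bool.Properties as Bool
open import Data.Fin.Base using (Fin; zero; suc; combine; finToFun; funToFin)
open import Data.Fin.Permutation using (permutation)
import Data.Fin.Properties as Fin
open import Data.Fin.Subset using (Subset; _∈_; _∩_; _∪_; ∁; ⊥; ∣_∣)
open import Data.Fin.Subset.Properties using (∣⊥∣≡0; ∣p∩q∣≤∣p∣; ∩-zeroʳ; ∩-comm)
open import Data.List.Base using (List; []; _∷_; length)
open import Data.List.Membership.Propositional using () renaming (_∈_ to _∈ˡ_; _∉_ to _∉ˡ_)
open import Data.List.Relation.Unary.All as All using (All)
open import Data.List.Relation.Unary.Any using (here; there)
open import Data.Nat.Base hiding (nonZero)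
open import Data.Nat.Properties
open import Data.Nat.Tactic.RingSolver using (solve-∀)
open import Data.Product using (∃-syntax; _,_)
open import Data.Sum.Base using (_⊎_; inj₁; inj₂; [_,_]′)
open import Data.Vec.Base using (Vec; []; _∷_; lookup; map; tabulate; zipWith; here; there)
open import Data.Vec.Properties
  using ( ≡-dec; ∷-injectiveˡ; ∷-injectiveʳ; lookup-map; lookup∘tabulate; tabulate∘lookup
        ; tabulate-∘; tabulate-cong)
open import Function.Base using (_∘_; id; const)
open import Function.Bundles using (_⇔_; mk⇔; Equivalence; Inverse)
open import Function.Definitions using (Injective)
open import Level using (0ℓ)
open import Relation.Binary.Core using (Rel)
open import Relation.Binary.Definitions using (DecidableEquality)
open import Relation.Binary.PropositionalEquality
  using (_≡_; _≢_; _≗_; refl; ≢-sym; sym; trans; cong; cong₂; subst; module ≡-Reasoning)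
open import Relation.Nullary using (¬_; Dec; yes; no; contradiction)
open import Relation.Nullary.Decidable
  using (does; T?; map′; dec-true; dec-false; does-⇔; _→-dec_; _⊎-dec_)
open import Relation.Unary using (Pred; Decidable)

open import Algebra.Properties.Semiring.Sum +-*-semiring

private
  variable
    n k l : ℕ

-- Sums and indicators

ι : {P : Set} → Dec P → ℕ
ι P? = if does P? then 1 else 0

ι-yes : {P : Set} (P? : Dec P) → P → ι P? ≡ 1
ι-yes P? p rewrite dec-true P? p = refl

ι-no : {P : Set} (P? : Dec P) → ¬ P → ι P? ≡ 0
ι-no P? ¬p rewrite dec-false P? ¬p = refl

ι-≤1 : {P : Set} (P? : Dec P) → ι P? ≤ 1
ι-≤1 (yes _) = ≤-refl
ι-≤1 (no _)  = z≤n

sum-mono-≤ : {f g : Fin n → ℕ} → (∀ i → f i ≤ g i) → sum f ≤ sum g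
sum-mono-≤ {zero}  f≤g = z≤n
sum-mono-≤ {suc n} f≤g = +-mono-≤ (f≤g zero) (sum-mono-≤ (f≤g ∘ suc))

sum-const : ∀ n c → ∑[ i < n ] c ≡ n * c
sum-const zero    c = refl
sum-const (suc n) c = cong (c +_) (sum-const n c)

sum-zero : {f : Fin n → ℕ} → (∀ i → f i ≡ 0) → sum f ≡ 0
sum-zero {n} f≡0 = trans (sum-cong-≗ f≡0) (sum-replicate-zero n)

term≤sum : (f : Fin n → ℕ) (i : Fin n) → f i ≤ sum f
term≤sum f zero    = m≤m+n _ _
term≤sum f (suc i) = ≤-trans (term≤sum (f ∘ suc) i) (m≤n+m _ _)

sum-ι≤1 : {P : Pred (Fin n) 0ℓ} (P? : Decidable P) →
          (∀ {i j} → P i → P j → i ≡ j) → ∑[ i < n ] ι (P? i) ≤ 1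
sum-ι≤1 {zero}  P? unique = z≤n
sum-ι≤1 {suc n} P? unique with P? zero
... | no _  = sum-ι≤1 (P? ∘ suc) λ p q → Fin.suc-injective (unique p q)
... | yes p = s≤s (≤-reflexive (sum-zero λ i → ι-no (P? (suc i)) λ q → Fin.0≢1+n (unique p q)))

sum-δ : (a : Fin n) (f : Fin n → ℕ) → ∑[ i < n ] (ι (a Fin.≟ i) * f i) ≡ f a
sum-δ {suc n} zero    f =
  trans (cong₂ _+_ (+-identityʳ (f zero)) (sum-zero {n} λ _ → refl)) (+-identityʳ (f zero))
sum-δ {suc n} (suc a) f = sum-δ a (f ∘ suc)

∣p∣≤sum : (p : Subset n) (f : Fin n → ℕ) → (∀ {i} → i ∈ p → 1 ≤ f i) → ∣ p ∣ ≤ sum f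
∣p∣≤sum []          f 1≤f = z≤n
∣p∣≤sum (true ∷ p)  f 1≤f = +-mono-≤ (1≤f here) (∣p∣≤sum p (f ∘ suc) (1≤f ∘ there))
∣p∣≤sum (false ∷ p) f 1≤f = m≤n⇒m≤o+n (f zero) (∣p∣≤sum p (f ∘ suc) (1≤f ∘ there))

-- Weakening `P` to a decidable `Q` lets success be counted by an indicator.
Prob≥2/3⇒sum-ι : {P Q : Pred (Fin n) 0ℓ} → Prob≥2/3 P → (∀ {r} → P r → Q r) →
                 (Q? : Decidable Q) → 2 * n ≤ 3 * ∑[ r < n ] ι (Q? r)
Prob≥2/3⇒sum-ι (G , large , good) P⇒Q Q? =
  ≤-trans large (*-monoʳ-≤ 3 (∣p∣≤sum G _ λ {r} r∈G → ≤-reflexive (sym (ι-yes (Q? r) (P⇒Q (good r∈G))))))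

-- Double counting over instances and seeds, as in Yao's principle: each instance is solved by two
-- thirds of the seeds, while no single seed solves many instances. `V` is the total weight of the
-- oracles of one instance: 1 for search, the number of injections for Simon's problem.
averaging : ∀ {I R} .{{_ : NonZero R}} (V bound : ℕ) (χ : Fin I → Fin R → ℕ) →
            (∀ i → 2 * R * V ≤ 3 * ∑[ r < R ] χ i r) →
            (∀ r → ∑[ i < I ] χ i r ≤ bound) →
            2 * (I * V) ≤ 3 * bound
averaging {I} {R} V bound χ lower upper = *-cancelˡ-≤ R (begin
  R * (2 * (I * V))                  ≡⟨ lhs R I V ⟩
  I * (2 * R * V)                    ≡⟨ sum-const I _ ⟨
  ∑[ i < I ] (2 * R * V)             ≤⟨ sum-mono-≤ lower ⟩
  ∑[ i < I ] (3 * ∑[ r < R ] χ i r)  ≡⟨ *-distribˡ-sum 3 (λ i → ∑[ r < R ] χ i r) ⟨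
  3 * ∑[ i < I ] ∑[ r < R ] χ i r    ≡⟨ cong (3 *_) (∑-comm χ) ⟩
  3 * ∑[ r < R ] ∑[ i < I ] χ i r    ≤⟨ *-monoʳ-≤ 3 (sum-mono-≤ upper) ⟩
  3 * ∑[ r < R ] bound               ≡⟨ cong (3 *_) (sum-const R bound) ⟩
  3 * (R * bound)                    ≡⟨ rhs R bound ⟩
  R * (3 * bound)                    ∎)
  where
  open ≤-Reasoning
  lhs : ∀ R I V → R * (2 * (I * V)) ≡ I * (2 * R * V)
  lhs = solve-∀
  rhs : ∀ R b → 3 * (R * b) ≡ R * (3 * b)
  rhs = solve-∀

-- Enumerations

funToFin-cong : {f g : Fin k → Fin l} → f ≗ g → funToFin f ≡ funToFin g
funToFin-cong {k = zero}  f≗g = refl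
funToFin-cong {k = suc k} f≗g = cong₂ combine (f≗g zero) (funToFin-cong (f≗g ∘ suc))

module 2↔Bool = Inverse Fin.2↔Bool

encode : Vec Bool n → Fin (2 ^ n)
encode x = funToFin (2↔Bool.from ∘ lookup x)

decode : Fin (2 ^ n) → Vec Bool n
decode i = tabulate (2↔Bool.to ∘ finToFun i)

decode-encode : (x : Vec Bool n) → decode (encode x) ≡ x
decode-encode x = trans (tabulate-cong λ i →
  trans (cong 2↔Bool.to (Fin.finToFun-funToFin _ i)) (2↔Bool.strictlyInverseˡ _)) (tabulate∘lookup x)

encode-decode : (i : Fin (2 ^ n)) → encode {n} (decode i) ≡ i
encode-decode {n} i = trans (funToFin-cong {n} {2} λ j →
  trans (cong 2↔Bool.from (lookup∘tabulate (2↔Bool.to ∘ finToFun i) j)) (2↔Bool.strictlyInverseʳ _))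
  (Fin.funToFin-finToFin {n} {2} i)

decode-injective : {i j : Fin (2 ^ n)} → decode {n} i ≡ decode j → i ≡ j
decode-injective {n} eq = trans (sym (encode-decode {n} _)) (trans (cong encode eq) (encode-decode {n} _))

encode-injective : {x y : Vec Bool n} → encode x ≡ encode y → x ≡ y
encode-injective eq = trans (sym (decode-encode _)) (trans (cong decode eq) (decode-encode _))

injective? : (f : Fin k → Fin l) → Dec (Injective _≡_ _≡_ f)
injective? f = map′ (λ inj {x} {y} → inj x y) (λ inj x y → inj)
  (Fin.all? λ x → Fin.all? λ y → (f x Fin.≟ f y) →-dec (x Fin.≟ y))

-- Congruences and quotients of powers

lift : Op k Bool → Op k (Vec Bool n)
lift f xs = tabulate λ i → f (map (λ x → lookup x i) xs)

Compatible : {X : Set} → Rel X 0ℓ → Op k X → Set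
Compatible R f = ∀ xs ys → (∀ i → R (lookup xs i) (lookup ys i)) → R (f xs) (f ys)

lift-proj : (i : Fin k) (xs : Vec (Vec Bool n) k) → lift (λ ys → lookup ys i) xs ≡ lookup xs i
lift-proj i xs = trans (tabulate-cong λ j → lookup-map i _ xs) (tabulate∘lookup _)

lift-comp : (f : Op k Bool) (gs : Fin k → Op l Bool) (xs : Vec (Vec Bool n) l) →
            lift (λ ys → f (tabulate λ j → gs j ys)) xs ≡ lift f (tabulate λ j → lift (gs j) xs)
lift-comp f gs xs = tabulate-cong λ i → cong f (trans
  (tabulate-cong λ j → sym (lookup∘tabulate _ i))
  (tabulate-∘ (λ x → lookup x i) (λ j → lift (gs j) xs)))

lift-binary : (_·_ : Bool → Bool → Bool) (f : Op 2 Bool) →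
              (∀ a b → f (a ∷ b ∷ []) ≡ a · b) →
              (x y : Vec Bool n) → lift f (x ∷ y ∷ []) ≡ zipWith _·_ x y
lift-binary _·_ f f≡· []      []      = refl
lift-binary _·_ f f≡· (a ∷ x) (b ∷ y) = cong₂ _∷_ (f≡· a b) (lift-binary _·_ f f≡· x y)

-- By induction on the construction of the term operation, compatibility need only be checked for
-- the generators of the larger clone.
clone-compatible : {S : Signature} (B : Interpretation S Bool) (R : Rel (Vec Bool n) 0ℓ) →
                   (∀ o → Compatible R (lift (B o))) →
                   {f : Op k Bool} → Clo B k f → Compatible R (lift f)
clone-compatible B R compat (basic o) = compat o
clone-compatible B R compat (proj i) xs ys xRy
  rewrite lift-proj i xs | lift-proj i ys = xRy i
clone-compatible B R compat (comp {f = f} {gs} f∈ gs∈) xs ys xRy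
  rewrite lift-comp f gs xs | lift-comp f gs ys =
  clone-compatible B R compat f∈ _ _ λ i →
    subst (λ z → R z _) (sym (lookup∘tabulate (λ j → lift (gs j) xs) i))
      (subst (R _) (sym (lookup∘tabulate (λ j → lift (gs j) ys) i))
        (clone-compatible B R compat (gs∈ i) xs ys xRy))
clone-compatible B R compat (ext f≗g f∈) xs ys xRy =
  subst (λ z → R z _) (tabulate-cong λ _ → f≗g _)
    (subst (R _) (tabulate-cong λ _ → f≗g _) (clone-compatible B R compat f∈ xs ys xRy))

bounded-compatible : (_·_ : Bool → Bool → Bool) (φ : Vec Bool n → Vec Bool n) →
  (∀ {x x′ y y′} → φ x ≡ φ x′ → φ y ≡ φ y′ → φ (zipWith _·_ x y) ≡ φ (zipWith _·_ x′ y′)) →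
  ∀ o → Compatible (ker φ) (lift (bounded _·_ o))
bounded-compatible _·_ φ cong· binary (x ∷ y ∷ []) (x′ ∷ y′ ∷ []) eq
  rewrite lift-binary _·_ (bounded _·_ binary) (λ _ _ → refl) x y
        | lift-binary _·_ (bounded _·_ binary) (λ _ _ → refl) x′ y′ = cong· (eq zero) (eq (suc zero))
bounded-compatible _·_ φ cong· zero [] [] eq = refl
bounded-compatible _·_ φ cong· one  [] [] eq = refl

-- An algorithm may depend on the universe of the codomain but not on its operations. Transporting
-- the operations to a fixed set `Y` of labels therefore makes all instances face the same decision
-- trees.
module Quotient {S : Signature} (B : Interpretation S Bool) {Y : Set} (_≟_ : DecidableEquality Y)
  (φ : Vec Bool n → Y) (compat : ∀ o → Compatible (ker φ) (lift (B o))) where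

  section : Y → Vec Bool n
  section y with Fin.any? (λ i → φ (decode i) ≟ y)
  ... | yes (i , _) = decode i
  -- A label outside the image of `φ` names no class; its section is an arbitrary choice.
  ... | no _        = ⊥

  φ-section : ∀ x → φ x ≡ φ (section (φ x))
  φ-section x with Fin.any? (λ i → φ (decode i) ≟ φ x)
  ... | yes (_ , eq) = sym eq
  ... | no ∄         = contradiction (encode x , cong φ (decode-encode x)) ∄

  algebra : Algebra S
  algebra = record { Carrier = Y ; interp = λ o ys → φ (lift (B o) (map section ys)) }

  hom : Hom (Power B n) algebra
  hom = record
    { fun   = φ
    ; isHom = λ o xs → compat o xs _ λ i → trans (φ-section (lookup xs i))
        (cong φ (sym (trans (lookup-map i section (map φ xs)) (cong section (lookup-map i φ xs)))))
    }

IsKernel⇒does : {X Y : Set} {φ : X → Y} {θ : X → X → Bool} → (∀ a b → T (θ a b) ⇔ ker φ a b) →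
                ∀ {a b} {P : Set} (P? : Dec P) → (ker φ a b → P) → (P → ker φ a b) →
                θ a b ≡ does P?
IsKernel⇒does {θ = θ} isKer {a} {b} P? to from = does-⇔
  (mk⇔ (to ∘ Equivalence.to (isKer a b)) (Equivalence.from (isKer a b) ∘ from)) (T? (θ a b)) P?

-- Semilattices: searching for a hidden ideal

_≟ᵛ_ : DecidableEquality (Vec Bool n)
_≟ᵛ_ = ≡-dec Bool._≟_

module Ideal {I : Pred (Subset n) 0ℓ} (I? : Decidable I) (I-⊥ : I ⊥) (I-∩ : ∀ x y → I x → I (x ∩ y)) where

  -- The kernel is the Rees congruence: since `⊥` lies in the ideal, it can label the collapsed
  -- class, and all other classes are singletons.
  collapse : Subset n → Subset n
  collapse x = if does (I? x) then ⊥ else x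

  collapse-∈ : ∀ {x} → I x → collapse x ≡ ⊥
  collapse-∈ {x} x∈I rewrite dec-true (I? x) x∈I = refl

  collapse-∉ : ∀ {x} → ¬ I x → collapse x ≡ x
  collapse-∉ {x} x∉I rewrite dec-false (I? x) x∉I = refl

  -- If `x` lies in the ideal, so do `x ∩ y` and `⊥ ∩ y`; otherwise `collapse` leaves `x` alone. By
  -- commutativity, treating one argument is enough.
  collapse-∩ : ∀ x y → collapse (x ∩ y) ≡ collapse (collapse x ∩ y)
  collapse-∩ x y with I? x
  ... | yes x∈I = trans (collapse-∈ (I-∩ x y x∈I)) (sym (collapse-∈ (I-∩ ⊥ y I-⊥)))
  ... | no  _   = refl

  collapse-congˡ : ∀ {x x′} y → collapse x ≡ collapse x′ → collapse (x ∩ y) ≡ collapse (x′ ∩ y)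
  collapse-congˡ {x} {x′} y eq =
    trans (collapse-∩ x y) (trans (cong (λ z → collapse (z ∩ y)) eq) (sym (collapse-∩ x′ y)))

  collapse-cong : ∀ {x x′ y y′} → collapse x ≡ collapse x′ → collapse y ≡ collapse y′ →
                  collapse (x ∩ y) ≡ collapse (x′ ∩ y′)
  collapse-cong {x} {x′} {y} {y′} eq eq′
    rewrite collapse-congˡ y eq | ∩-comm x′ y | ∩-comm x′ y′ = collapse-congˡ x′ eq′

-- This is why one further set can be added to all the smaller ones without losing closure under
-- intersection with arbitrary sets.
∩-shrinks : (x y : Subset n) → ∣ x ∩ y ∣ < ∣ x ∣ ⊎ x ∩ y ≡ x
∩-shrinks []          []          = inj₂ refl
∩-shrinks (false ∷ x) (_ ∷ y)     = [ inj₁ , inj₂ ∘ cong (false ∷_) ]′ (∩-shrinks x y)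
∩-shrinks (true ∷ x)  (true ∷ y)  = [ inj₁ ∘ s<s , inj₂ ∘ cong (true ∷_) ]′ (∩-shrinks x y)
∩-shrinks (true ∷ x)  (false ∷ y) = inj₁ (s≤s (∣p∩q∣≤∣p∣ x y))

module _ (a : Subset n) where

  Below : Pred (Subset n) 0ℓ
  Below x = ∣ x ∣ < ∣ a ∣ ⊎ x ≡ a

  below? : Decidable Below
  below? x = (∣ x ∣ <? ∣ a ∣) ⊎-dec (x ≟ᵛ a)

  below-∩ : ∀ x y → Below x → Below (x ∩ y)
  below-∩ x y (inj₁ x<a)  = inj₁ (≤-<-trans (∣p∩q∣≤∣p∣ x y) x<a)
  below-∩ _ y (inj₂ refl) = ∩-shrinks a y

  below-⊥ : Below ⊥
  below-⊥ = subst Below (∩-zeroʳ a) (below-∩ a ⊥ (inj₂ refl))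

-- Each bit is followed by its negation, so every pair of positions contributes exactly one element
-- and all images have the same size. For odd `n` the last position stays empty.
doubling : ∀ n → Vec Bool ⌊ n /2⌋ → Subset n
doubling 0             []      = []
doubling 1             []      = false ∷ []
doubling (suc (suc n)) (b ∷ v) = b ∷ not b ∷ doubling n v

∣doubling∣ : ∀ n v → ∣ doubling n v ∣ ≡ ⌊ n /2⌋
∣doubling∣ 0             []          = refl
∣doubling∣ 1             []          = refl
∣doubling∣ (suc (suc n)) (true ∷ v)  = cong suc (∣doubling∣ n v)
∣doubling∣ (suc (suc n)) (false ∷ v) = cong suc (∣doubling∣ n v)

doubling-injective : ∀ n {v w} → doubling n v ≡ doubling n w → v ≡ w
doubling-injective 0             {[]}    {[]}    eq = refl
doubling-injective 1             {[]}    {[]}    eq = refl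
doubling-injective (suc (suc n)) {_ ∷ _} {_ ∷ _} eq =
  cong₂ _∷_ (∷-injectiveˡ eq) (doubling-injective n (∷-injectiveʳ (∷-injectiveʳ eq)))

-- Lower bound for unstructured search

module _ {X Y Z : Set} (_≟_ : DecidableEquality X) {I : ℕ}
  (φ : Fin I → X → Y) (φ₀ : X → Y) (a : Fin I → X) (a-injective : Injective _≡_ _≡_ a)
  (agree : ∀ i {x} → a i ≢ x → φ i x ≡ φ₀ x)
  {Q : Z → Pred (Fin I) 0ℓ} (Q? : ∀ z → Decidable (Q z))
  (unique : ∀ z {i j} → Q z i → Q z j → i ≡ j)
  where

  -- Follow the path of `t` under the reference oracle. Each query on it separates at most one
  -- instance from the reference, and the output at its end is right for at most one more.
  search-bound : ∀ t → ∑[ i < I ] ι (Q? (run (φ i) t) i) ≤ 1 + queries φ₀ t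
  search-bound (output z)  = sum-ι≤1 (Q? z) (unique z)
  search-bound (query x t) = begin
    ∑[ i < I ] ι (Q? (run (φ i) (t (φ i x))) i)                              ≤⟨ sum-mono-≤ step ⟩
    ∑[ i < I ] (ι (a i ≟ x) + ι (Q? (run (φ i) (t (φ₀ x))) i))
      ≡⟨ ∑-distrib-+ {I} _ _ ⟩
    ∑[ i < I ] ι (a i ≟ x) + ∑[ i < I ] ι (Q? (run (φ i) (t (φ₀ x))) i)      ≤⟨ +-mono-≤
      (sum-ι≤1 (λ i → a i ≟ x) (λ p q → a-injective (trans p (sym q)))) (search-bound (t (φ₀ x))) ⟩
    1 + (1 + queries φ₀ (t (φ₀ x)))   ∎
    where
    open ≤-Reasoning
    step : ∀ i → ι (Q? (run (φ i) (t (φ i x))) i) ≤ ι (a i ≟ x) + ι (Q? (run (φ i) (t (φ₀ x))) i)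
    -- The instance marked at `x` is conceded; every other one gives the reference answer.
    step i with a i ≟ x
    ... | yes _ = m≤n⇒m≤n+o _ (ι-≤1 (Q? _ i))
    ... | no aᵢ≢x rewrite agree i aᵢ≢x = ≤-refl

-- For ∨ the complement ν = ∁ turns joins into intersections; for ∧ take ν = id.
module Semilattice {S : Signature} (B : Interpretation S Bool) (_·_ : Bool → Bool → Bool)
  (B⪯ : B ⪯ Clo (bounded _·_)) (ν : Subset n → Subset n) (ν-involutive : ∀ x → ν (ν x) ≡ x)
  (ν-· : ∀ x y → ν (zipWith _·_ x y) ≡ ν x ∩ ν y) (0<m : 0 < ⌊ n /2⌋)
  where

  open HKP (Power B n)

  m I : ℕ
  m = ⌊ n /2⌋
  I = 2 ^ m

  module _ {J : Pred (Subset n) 0ℓ} (J? : Decidable J) (J-⊥ : J ⊥) (J-∩ : ∀ x y → J x → J (x ∩ y)) where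

    open Ideal J? J-⊥ J-∩

    collapse-compatible : ∀ o → Compatible (ker (collapse ∘ ν)) (lift (B o))
    collapse-compatible o = clone-compatible (bounded _·_) (ker (collapse ∘ ν))
      (bounded-compatible _·_ (collapse ∘ ν) λ {x} {x′} {y} {y′} eq eq′ →
        trans (cong collapse (ν-· x y)) (trans (collapse-cong eq eq′) (cong collapse (sym (ν-· x′ y′)))))
      (B⪯ _ (basic o))

    module IdealQuotient = Quotient B _≟ᵛ_ (collapse ∘ ν) collapse-compatible

  a : Fin I → Subset n
  a i = doubling n (decode i)

  a-injective : Injective _≡_ _≡_ a
  a-injective = decode-injective {m} ∘ doubling-injective n

  ∣a∣ : ∀ i → ∣ a i ∣ ≡ m
  ∣a∣ i = ∣doubling∣ n (decode i)

  module Hidden (i : Fin I) = Ideal (below? (a i)) (below-⊥ (a i)) (below-∩ (a i))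
  module HiddenQuotient (i : Fin I) = IdealQuotient (below? (a i)) (below-⊥ (a i)) (below-∩ (a i))

  light? : Decidable λ (x : Subset n) → ∣ x ∣ < m
  light? x = ∣ x ∣ <? m

  light-⊥ : ∣ ⊥ {n} ∣ < m
  light-⊥ = subst (_< m) (sym (∣⊥∣≡0 n)) 0<m

  light-∩ : ∀ (x y : Subset n) → ∣ x ∣ < m → ∣ x ∩ y ∣ < m
  light-∩ x y = ≤-<-trans (∣p∩q∣≤∣p∣ x y)

  module Reference = Ideal light? light-⊥ light-∩
  module ReferenceQuotient = IdealQuotient light? light-⊥ light-∩

  -- The ideal of `a i` and the light sets differ only in `a i`, so the oracles differ only at the
  -- point that `ν` sends there.
  agree : ∀ i {x} → ν (a i) ≢ x → Hidden.collapse i (ν x) ≡ Reference.collapse (ν x)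
  agree i {x} νaᵢ≢x with light? (ν x) | below? (a i) (ν x)
  ... | yes x<m | yes x≤aᵢ       = trans (Hidden.collapse-∈ i x≤aᵢ) (sym (Reference.collapse-∈ x<m))
  ... | no  x≮m | no  x≰aᵢ       = trans (Hidden.collapse-∉ i x≰aᵢ) (sym (Reference.collapse-∉ x≮m))
  ... | yes x<m | no  x≰aᵢ       = contradiction (inj₁ (subst (_ <_) (sym (∣a∣ i)) x<m)) x≰aᵢ
  ... | no  x≮m | yes (inj₁ x<a) = contradiction (subst (_ <_) (∣a∣ i) x<a) x≮m
  ... | no  _   | yes (inj₂ eq)  = contradiction (trans (cong ν (sym eq)) (ν-involutive _)) νaᵢ≢x

  below-antichain : ∀ {i j} → Below (a i) (a j) → i ≡ j
  below-antichain {i} {j} (inj₁ aⱼ<aᵢ) = contradiction (trans (∣a∣ j) (sym (∣a∣ i))) (<⇒≢ aⱼ<aᵢ)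
  below-antichain         (inj₂ aⱼ≡aᵢ) = sym (a-injective aⱼ≡aᵢ)

  a≢⊥ : ∀ j → a j ≢ ⊥
  a≢⊥ j eq = contradiction (trans (sym (∣a∣ j)) (trans (cong ∣_∣ eq) (∣⊥∣≡0 n))) (≢-sym (<⇒≢ 0<m))

  -- Only the pairs of `ν ⊥` with a candidate are inspected: a finite, hence decidable, part of the
  -- kernel that already pins down `i`.
  Identifies : (A → A → Bool) → Pred (Fin I) 0ℓ
  Identifies θ i = ∀ j → θ (ν ⊥) (ν (a j)) ≡ does (i Fin.≟ j)

  identifies? : ∀ θ → Decidable (Identifies θ)
  identifies? θ i = Fin.all? λ j → θ (ν ⊥) (ν (a j)) Bool.≟ does (i Fin.≟ j)

  unique : ∀ θ {i j} → Identifies θ i → Identifies θ j → i ≡ j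
  unique θ {i} {j} p q with j Fin.≟ i | trans (sym (p i)) (q i)
  ... | yes eq | _  = sym eq
  ... | no _   | eq rewrite dec-true (i Fin.≟ i) refl = contradiction eq λ ()

  -- The candidates all have `m` elements, so the ideal of `a i` contains no candidate but `a i`;
  -- the others remain apart from `⊥` because `m` is positive.
  kernel-identifies : ∀ i {θ} → IsKernel (Hidden.collapse i ∘ ν) θ → Identifies θ i
  kernel-identifies i isKer j = IsKernel⇒does isKer (i Fin.≟ j) to from
    where
    open Hidden i
    collapse-ν⊥ : collapse (ν (ν ⊥)) ≡ ⊥
    collapse-ν⊥ = trans (cong collapse (ν-involutive ⊥)) (collapse-∈ (below-⊥ (a i)))
    from : i ≡ j → collapse (ν (ν ⊥)) ≡ collapse (ν (ν (a j)))
    from refl = trans collapse-ν⊥ (sym (trans (cong collapse (ν-involutive (a i))) (collapse-∈ (inj₂ refl))))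
    to : collapse (ν (ν ⊥)) ≡ collapse (ν (ν (a j))) → i ≡ j
    to eq with below? (a i) (a j)
    ... | yes aⱼ≤aᵢ = below-antichain aⱼ≤aᵢ
    ... | no  aⱼ≰aᵢ = contradiction
      (trans (sym (collapse-∉ aⱼ≰aᵢ)) (trans (cong collapse (sym (ν-involutive (a j))))
        (trans (sym eq) collapse-ν⊥)))
      (a≢⊥ j)

  bound : (M : Algorithm) → Solves M → (q : ℕ) → MakesAtMost M q → 2 * (I * 1) ≤ 3 * (1 + q)
  bound M solves q makes = averaging {{nonZero (M A _≟ᵛ_)}} 1 (1 + q) (λ i r → ι (correct? i r)) lower
    λ r → ≤-trans
      (search-bound _≟ᵛ_ φ (Reference.collapse ∘ ν) (ν ∘ a) νa-injective agree identifies? unique (t r))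
      -- The query bound speaks of homomorphisms only, so the reference oracle has to be one as
      -- well.
      (s≤s (makes _ _≟ᵛ_ ReferenceQuotient.hom r))
    where
    R : ℕ
    R = seeds (M A _≟ᵛ_)
    t : Fin R → DecisionTree A A (A → A → Bool)
    t = tree (M A _≟ᵛ_)
    φ : Fin I → A → A
    φ i = Hidden.collapse i ∘ ν
    correct? : ∀ i → Decidable λ r → Identifies (run (φ i) (t r)) i
    correct? i r = identifies? (run (φ i) (t r)) i
    νa-injective : Injective _≡_ _≡_ (ν ∘ a)
    νa-injective eq = a-injective (trans (sym (ν-involutive _)) (trans (cong ν eq) (ν-involutive _)))
    lower : ∀ i → 2 * R * 1 ≤ 3 * ∑[ r < R ] ι (correct? i r)
    lower i = ≤-trans (≤-reflexive (*-identityʳ (2 * R)))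
      (Prob≥2/3⇒sum-ι (solves _ _≟ᵛ_ (HiddenQuotient.hom i)) (kernel-identifies i) (correct? i))

-- Affine operations: Simon's problem

_⊕_ : Vec Bool n → Vec Bool n → Vec Bool n
_⊕_ = zipWith _xor_

infixl 6 _⊕_

⊕-involutive : (x s : Vec Bool n) → x ⊕ s ⊕ s ≡ x
⊕-involutive []      []      = refl
⊕-involutive (a ∷ x) (b ∷ s) = cong₂ _∷_
  (trans (Bool.xor-assoc a b b) (trans (cong (a xor_) (Bool.xor-same b)) (Bool.xor-identityʳ a)))
  (⊕-involutive x s)

⊕-swap : {x y s : Vec Bool n} → x ≡ y ⊕ s → x ⊕ s ≡ y
⊕-swap {y = y} {s} refl = ⊕-involutive y s

⊥-⊕ : (s : Vec Bool n) → ⊥ ⊕ s ≡ s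
⊥-⊕ []      = refl
⊥-⊕ (a ∷ s) = cong (a ∷_) (⊥-⊕ s)

⊕-cancelˡ : (x : Vec Bool n) {s t : Vec Bool n} → x ⊕ s ≡ x ⊕ t → s ≡ t
⊕-cancelˡ []      {[]}    {[]}    eq = refl
⊕-cancelˡ (a ∷ x) {b ∷ s} {c ∷ t} eq =
  cong₂ _∷_ (xor-cancelˡ a (∷-injectiveˡ eq)) (⊕-cancelˡ x (∷-injectiveʳ eq))
  where
  xor-cancelˡ : ∀ a {b c} → a xor b ≡ a xor c → b ≡ c
  xor-cancelˡ false eq = eq
  xor-cancelˡ true  eq = Bool.not-injective eq

-- The element of the coset {x, x ⊕ s} that vanishes at the first position where s does not.
rep : Vec Bool n → Vec Bool n → Vec Bool n
rep []          []      = []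
rep (false ∷ s) (a ∷ x) = a ∷ rep s x
rep (true ∷ s)  (a ∷ x) = false ∷ (if a then x ⊕ s else x)

rep-⊕ : (s x : Vec Bool n) → rep s (x ⊕ s) ≡ rep s x
rep-⊕ []          []          = refl
rep-⊕ (false ∷ s) (a ∷ x)     = cong₂ _∷_ (Bool.xor-identityʳ a) (rep-⊕ s x)
rep-⊕ (true ∷ s)  (true ∷ x)  = refl
rep-⊕ (true ∷ s)  (false ∷ x) = cong (false ∷_) (⊕-involutive x s)

rep-∈ : (s x : Vec Bool n) → rep s x ≡ x ⊎ rep s x ≡ x ⊕ s
rep-∈ []          []          = inj₁ refl
rep-∈ (false ∷ s) (a ∷ x)     =
  [ inj₁ ∘ cong (a ∷_) , inj₂ ∘ cong₂ _∷_ (sym (Bool.xor-identityʳ a)) ]′ (rep-∈ s x)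
rep-∈ (true ∷ s)  (true ∷ x)  = inj₂ refl
rep-∈ (true ∷ s)  (false ∷ x) = inj₁ refl

rep-⊥ : (x : Vec Bool n) → rep ⊥ x ≡ x
rep-⊥ []      = refl
rep-⊥ (a ∷ x) = cong (a ∷_) (rep-⊥ x)

rep-self : (s : Vec Bool n) → rep s ⊥ ≡ rep s s
rep-self s = trans (sym (rep-⊕ s ⊥)) (cong (rep s) (⊥-⊕ s))

rep-≡ : (s x y : Vec Bool n) → rep s x ≡ rep s y → x ≡ y ⊎ x ≡ y ⊕ s
rep-≡ s x y eq with rep-∈ s x | rep-∈ s y
... | inj₁ p | inj₁ q = inj₁ (trans (sym p) (trans eq q))
... | inj₁ p | inj₂ q = inj₂ (trans (sym p) (trans eq q))
... | inj₂ p | inj₁ q = inj₂ (sym (⊕-swap (trans (sym q) (trans (sym eq) p))))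
... | inj₂ p | inj₂ q = inj₁ (trans (sym (⊕-involutive x s))
                          (trans (cong (_⊕ s) (trans (sym p) (trans eq q))) (⊕-involutive y s)))

_⇔ᵛ_ : Vec Bool n → Vec Bool n → Vec Bool n
_⇔ᵛ_ = zipWith λ a b → does (a Bool.≟ b)

⇔ᵛ-comm : (x y : Vec Bool n) → x ⇔ᵛ y ≡ y ⇔ᵛ x
⇔ᵛ-comm []          []          = refl
⇔ᵛ-comm (false ∷ x) (false ∷ y) = cong (true ∷_) (⇔ᵛ-comm x y)
⇔ᵛ-comm (false ∷ x) (true ∷ y)  = cong (false ∷_) (⇔ᵛ-comm x y)
⇔ᵛ-comm (true ∷ x)  (false ∷ y) = cong (false ∷_) (⇔ᵛ-comm x y)
⇔ᵛ-comm (true ∷ x)  (true ∷ y)  = cong (true ∷_) (⇔ᵛ-comm x y)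

-- Coordinatewise, the biconditional is addition modulo 2 up to a constant, so it commutes with
-- translation by `s`.
⇔ᵛ-⊕ : (x y s : Vec Bool n) → (x ⊕ s) ⇔ᵛ y ≡ (x ⇔ᵛ y) ⊕ s
⇔ᵛ-⊕ []      []      []      = refl
⇔ᵛ-⊕ (a ∷ x) (b ∷ y) (c ∷ s) = cong₂ _∷_ (bits a b c) (⇔ᵛ-⊕ x y s)
  where
  bits : ∀ a b c → does ((a xor c) Bool.≟ b) ≡ does (a Bool.≟ b) xor c
  bits false false false = refl
  bits false false true  = refl
  bits false true  false = refl
  bits false true  true  = refl
  bits true  false false = refl
  bits true  false true  = refl
  bits true  true  false = refl
  bits true  true  true  = refl

rep-congˡ : (s x x′ y : Vec Bool n) → rep s x ≡ rep s x′ → rep s (x ⇔ᵛ y) ≡ rep s (x′ ⇔ᵛ y)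
rep-congˡ s x x′ y eq with rep-≡ s x x′ eq
... | inj₁ refl = refl
... | inj₂ refl = trans (cong (rep s) (⇔ᵛ-⊕ x′ y s)) (rep-⊕ s (x′ ⇔ᵛ y))

affine-compatible : (s : Vec Bool n) → ∀ o → Compatible (ker (rep s)) (lift (affine o))
affine-compatible s iff (x ∷ y ∷ []) (x′ ∷ y′ ∷ []) eq
  rewrite lift-binary (λ a b → does (a Bool.≟ b)) (affine iff) (λ _ _ → refl) x y
        | lift-binary (λ a b → does (a Bool.≟ b)) (affine iff) (λ _ _ → refl) x′ y′
        | rep-congˡ s x x′ y (eq zero) | ⇔ᵛ-comm x′ y | ⇔ᵛ-comm x′ y′ = rep-congˡ s y y′ x′ (eq (suc zero))
affine-compatible s zero [] [] eq = refl

-- Collisions among queries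

module _ {n : ℕ} where

  open import Data.List.Membership.DecPropositional (_≟ᵛ_ {n}) using (_∈?_)

  -- Phrased so that the trivial shift `⊥`, for which `x ⊕ s` is `x` itself, never produces a
  -- collision.
  Collisionless : Vec Bool n → List (Vec Bool n) → Set
  Collisionless s X = All (λ x → x ⊕ s ∈ˡ X → x ⊕ s ≡ x) X

  collisionless? : ∀ s X → Dec (Collisionless s X)
  collisionless? s X = All.all? (λ x → ((x ⊕ s) ∈? X) →-dec ((x ⊕ s) ≟ᵛ x)) X

  collisionless-∷ : ∀ {s x X} → Collisionless s X → x ⊕ s ∉ˡ X → Collisionless s (x ∷ X)
  collisionless-∷ {s} {x} {X} free x⊕s∉X = All.tabulate λ where
    (here refl) (here eq)  → eq
    (here refl) (there ∈X) → contradiction ∈X x⊕s∉X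
    (there y∈X) (there ∈X) → All.lookup free y∈X ∈X
    (there y∈X) (here eq)  → contradiction (subst (_∈ˡ X) (sym (⊕-swap (sym eq))) y∈X) x⊕s∉X

  -- Each earlier query `y` excludes a single shift, namely `x ⊕ y`.
  count-collisions : ∀ x X → ∑[ i < 2 ^ n ] ι ((x ⊕ decode i) ∈? X) ≤ length X
  count-collisions x []      = ≤-reflexive (sum-zero {2 ^ n} λ _ → refl)
  count-collisions x (y ∷ X) = begin
    ∑[ i < 2 ^ n ] ι ((x ⊕ decode i) ∈? (y ∷ X))                                ≤⟨ sum-mono-≤ step ⟩
    ∑[ i < 2 ^ n ] (ι ((x ⊕ decode i) ≟ᵛ y) + ι ((x ⊕ decode i) ∈? X))
      ≡⟨ ∑-distrib-+ {2 ^ n} _ _ ⟩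
    ∑[ i < 2 ^ n ] ι ((x ⊕ decode i) ≟ᵛ y) + ∑[ i < 2 ^ n ] ι ((x ⊕ decode i) ∈? X)
      ≤⟨ +-mono-≤
           (sum-ι≤1 (λ i → (x ⊕ decode i) ≟ᵛ y) λ p q → decode-injective {n} (⊕-cancelˡ x (trans p (sym q))))
           (count-collisions x X) ⟩
    1 + length X   ∎
    where
    open ≤-Reasoning
    step : ∀ i → ι ((x ⊕ decode i) ∈? (y ∷ X)) ≤ ι ((x ⊕ decode i) ≟ᵛ y) + ι ((x ⊕ decode i) ∈? X)
    step i with (x ⊕ decode i) ≟ᵛ y | (x ⊕ decode i) ∈? X
    ... | yes _ | yes _ = s≤s z≤n
    ... | yes _ | no _  = s≤s z≤n
    ... | no _  | yes _ = ≤-refl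
    ... | no _  | no _  = ≤-refl

  -- An involution of the cube that restricts to rep s on X.
  module Swap (s : Vec Bool n) (X : List (Vec Bool n)) (free : Collisionless s X) where

    swap : Vec Bool n → Vec Bool n
    swap z with z ∈? X | (z ⊕ s) ∈? X
    ... | yes _ | _     = rep s z
    -- The partner of `z` in `X` is already sent to `rep s z`, so `z` takes the other point of the
    -- coset.
    ... | no _  | yes _ = rep s z ⊕ s
    ... | no _  | no _  = z

    swap-∈ : ∀ {z} → z ∈ˡ X → swap z ≡ rep s z
    swap-∈ {z} z∈X with z ∈? X | (z ⊕ s) ∈? X
    ... | yes _  | _ = refl
    ... | no z∉X | _ = contradiction z∈X z∉X

    swap-⊕∈ : ∀ {z} → z ∉ˡ X → z ⊕ s ∈ˡ X → swap z ≡ rep s z ⊕ s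
    swap-⊕∈ {z} z∉X z⊕s∈X with z ∈? X | (z ⊕ s) ∈? X
    ... | yes z∈X | _         = contradiction z∈X z∉X
    ... | no _    | yes _     = refl
    ... | no _    | no z⊕s∉X  = contradiction z⊕s∈X z⊕s∉X

    swap-∉ : ∀ {z} → z ∉ˡ X → z ⊕ s ∉ˡ X → swap z ≡ z
    swap-∉ {z} z∉X z⊕s∉X with z ∈? X | (z ⊕ s) ∈? X
    ... | yes z∈X | _         = contradiction z∈X z∉X
    ... | no _    | yes z⊕s∈X = contradiction z⊕s∈X z⊕s∉X
    ... | no _    | no _      = refl

    swap-fixed : ∀ {z} → swap z ≡ z → swap (swap z) ≡ z
    swap-fixed eq = trans (cong swap eq) eq

    swap-involutive : ∀ z → swap (swap z) ≡ z
    swap-involutive z = cases (z ∈? X) ((z ⊕ s) ∈? X) (rep-∈ s z)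
      where
      z⊕s⊕s≡z : z ⊕ s ⊕ s ≡ z
      z⊕s⊕s≡z = ⊕-involutive z s
      cases : Dec (z ∈ˡ X) → Dec (z ⊕ s ∈ˡ X) → rep s z ≡ z ⊎ rep s z ≡ z ⊕ s → swap (swap z) ≡ z
      cases (no z∉X)  (no z⊕s∉X) _ = swap-fixed (swap-∉ z∉X z⊕s∉X)
      cases (yes z∈X) _ (inj₁ eq) = swap-fixed (trans (swap-∈ z∈X) eq)
      -- With both points of the coset in `X`, the absence of collisions forces them to coincide.
      cases (yes z∈X) (yes z⊕s∈X) (inj₂ eq) =
        swap-fixed (trans (swap-∈ z∈X) (trans eq (All.lookup free z∈X z⊕s∈X)))
      cases (yes z∈X) (no z⊕s∉X) (inj₂ eq) = begin
        swap (swap z)       ≡⟨ cong swap (trans (swap-∈ z∈X) eq) ⟩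
        swap (z ⊕ s)        ≡⟨ swap-⊕∈ z⊕s∉X (subst (_∈ˡ X) (sym z⊕s⊕s≡z) z∈X) ⟩
        rep s (z ⊕ s) ⊕ s   ≡⟨ cong (_⊕ s) (trans (rep-⊕ s z) eq) ⟩
        z ⊕ s ⊕ s           ≡⟨ z⊕s⊕s≡z ⟩
        z   ∎
        where open ≡-Reasoning
      cases (no z∉X) (yes z⊕s∈X) (inj₁ eq) = begin
        swap (swap z)       ≡⟨ cong swap (trans (swap-⊕∈ z∉X z⊕s∈X) (cong (_⊕ s) eq)) ⟩
        swap (z ⊕ s)        ≡⟨ swap-∈ z⊕s∈X ⟩
        rep s (z ⊕ s)       ≡⟨ trans (rep-⊕ s z) eq ⟩
        z   ∎
        where open ≡-Reasoning
      cases (no z∉X) (yes z⊕s∈X) (inj₂ eq) =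
        swap-fixed (trans (swap-⊕∈ z∉X z⊕s∈X) (trans (cong (_⊕ s) eq) z⊕s⊕s≡z))

-- The sum 1 + k + (k + 1) + ... + (k + q - 1): a query made after l others is charged l values of
-- `s`, and the 1 is for the output.
birthday : ℕ → ℕ → ℕ
birthday k zero    = 1
birthday k (suc q) = k + birthday (suc k) q

birthday-≤ : ∀ k q → birthday k q ≤ 1 + q * (k + q)
birthday-≤ k zero    = ≤-refl
birthday-≤ k (suc q) = begin
  k + birthday (suc k) q      ≤⟨ +-monoʳ-≤ k (birthday-≤ (suc k) q) ⟩
  k + (1 + q * (suc k + q))   ≤⟨ +-monoʳ-≤ k (s≤s (m≤n+m _ (1 + q))) ⟩
  k + (1 + (1 + q + q * (suc k + q))) ≡⟨ lemma k q ⟩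
  1 + suc q * (k + suc q)   ∎
  where
  open ≤-Reasoning
  lemma : ∀ k q → k + (1 + (1 + q + q * (suc k + q))) ≡ 1 + suc q * (k + suc q)
  lemma = solve-∀

-- The hidden subgroup is {⊥, s}, and its cosets are labelled by a random injection.  Injections
-- are drawn as arbitrary functions j weighted by w j.
module Simon (n : ℕ) where

  open import Data.List.Membership.DecPropositional (_≟ᵛ_ {n}) using (_∈?_)

  N : ℕ
  N = 2 ^ n

  Label : Set
  Label = Fin (N ^ N)

  label : Label → Fin N → Fin N
  label = finToFun {N} {N}

  w : Label → ℕ
  w j = ι (injective? (label j))

  φ₀ : Label → Vec Bool n → Fin N
  φ₀ j x = label j (encode x)

  φ : Vec Bool n → Label → Vec Bool n → Fin N
  φ s j x = φ₀ j (rep s x)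

  W : ℕ
  W = ∑[ j < N ^ N ] w j

  W-nonZero : NonZero W
  W-nonZero = >-nonZero
    (≤-trans (≤-reflexive (sym (ι-yes (injective? (label identity)) inj))) (term≤sum w identity))
    where
    identity : Label
    identity = funToFin {N} {N} id
    inj : Injective _≡_ _≡_ (label identity)
    inj {x} {y} eq = trans (sym (Fin.finToFun-funToFin {N} {N} id x)) (trans eq (Fin.finToFun-funToFin {N} {N} id y))

  -- Such a `g` stands for an event determined by the answers to the queries in `X`, for instance
  -- the transcript so far.
  LocalOn : List (Vec Bool n) → ((Vec Bool n → Fin N) → ℕ) → Set
  LocalOn X g = ∀ {h h′} → (∀ {x} → x ∈ˡ X → h x ≡ h′ x) → g h ≡ g h′

  -- Precomposing with `swap` permutes the labellings, preserves injectivity and turns `φ₀` into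
  -- `φ s` on `X`. What depends on `X` alone therefore has the same weight under both oracles.
  relabel : ∀ {s X g} → Collisionless s X → LocalOn X g →
            ∑[ j < N ^ N ] (w j * g (φ s j)) ≡ ∑[ j < N ^ N ] (w j * g (φ₀ j))
  relabel {s} {X} {g} free local = sym (begin
    ∑[ j < N ^ N ] (w j * g (φ₀ j))
      ≡⟨ ∑-permute (λ j → w j * g (φ₀ j)) (permutation π π π-involutive π-involutive) ⟩
    ∑[ j < N ^ N ] (w (π j) * g (φ₀ (π j)))
      ≡⟨ sum-cong-≗ (λ j → cong₂ _*_ (w-π j) (local (agree j))) ⟩
    ∑[ j < N ^ N ] (w j * g (φ s j))               ∎)
    where
    open ≡-Reasoning
    open Swap s X free
    σ : Fin N → Fin N
    σ i = encode (swap (decode i))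
    σ-involutive : ∀ i → σ (σ i) ≡ i
    σ-involutive i = trans (cong (encode ∘ swap) (decode-encode (swap (decode i))))
      (trans (cong encode (swap-involutive (decode i))) (encode-decode {n} i))
    π : Label → Label
    π j = funToFin {N} {N} (label j ∘ σ)
    label-π : ∀ j → label (π j) ≗ label j ∘ σ
    label-π j = Fin.finToFun-funToFin {N} {N} (label j ∘ σ)
    π-involutive : ∀ j → π (π j) ≡ j
    π-involutive j = trans
      (funToFin-cong {N} {N} λ i → trans (label-π j (σ i)) (cong (label j) (σ-involutive i)))
      (Fin.funToFin-finToFin {N} {N} j)
    w-π : ∀ j → w (π j) ≡ w j
    w-π j = cong (if_then 1 else 0) (does-⇔ (mk⇔ to from) (injective? (label (π j))) (injective? (label j)))
      where
      σ-injective : ∀ {x y} → σ x ≡ σ y → x ≡ y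
      σ-injective eq = trans (sym (σ-involutive _)) (trans (cong σ eq) (σ-involutive _))
      to : Injective _≡_ _≡_ (label (π j)) → Injective _≡_ _≡_ (label j)
      to inj {x} {y} eq = σ-injective (inj (trans (at x) (trans eq (sym (at y)))))
        where
        at : ∀ x → label (π j) (σ x) ≡ label j x
        at x = trans (label-π j (σ x)) (cong (label j) (σ-involutive x))
      from : Injective _≡_ _≡_ (label j) → Injective _≡_ _≡_ (label (π j))
      from inj {x} {y} eq = σ-injective (inj (trans (sym (label-π j x)) (trans eq (label-π j y))))
    agree : ∀ j {x} → x ∈ˡ X → φ₀ (π j) x ≡ φ s j x
    agree j {x} x∈X = trans (label-π j (encode x)) (cong (label j ∘ encode)
      (trans (cong swap (decode-encode x)) (swap-∈ x∈X)))

  module _ {Z : Set} {Q : Z → Pred (Fin N) 0ℓ} (Q? : ∀ z → Decidable (Q z))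
    (unique : ∀ z {i j} → Q z i → Q z j → i ≡ j) where

    -- The unnormalised probability, over the labellings of instance `i`, that the event `g` occurs
    -- and `t` succeeds.
    success : DecisionTree (Vec Bool n) (Fin N) Z → ((Vec Bool n → Fin N) → ℕ) → Fin N → ℕ
    success t g i = ∑[ j < N ^ N ] (w j * g (φ (decode i) j) * ι (Q? (run (φ (decode i) j) t) i))

    success-≤ : ∀ t {X g} → LocalOn X g → ∀ i → Collisionless (decode i) X →
                success t g i ≤ ∑[ j < N ^ N ] (w j * g (φ₀ j))
    success-≤ t {X} {g} local i free = begin
      success t g i                                ≤⟨ sum-mono-≤ (λ j → ≤-trans
        (*-monoʳ-≤ (w j * g (φ (decode i) j)) (ι-≤1 (Q? _ i))) (≤-reflexive (*-identityʳ _))) ⟩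
      ∑[ j < N ^ N ] (w j * g (φ (decode i) j))    ≡⟨ relabel free local ⟩
      ∑[ j < N ^ N ] (w j * g (φ₀ j))   ∎
      where open ≤-Reasoning

    -- Restricts the event `g` to the oracles that answer the query `x` with `y`.
    at : Vec Bool n → Fin N → ((Vec Bool n → Fin N) → ℕ) → (Vec Bool n → Fin N) → ℕ
    at x y g h = ι (h x Fin.≟ y) * g h

    at-local : ∀ {x y X g} → LocalOn X g → LocalOn (x ∷ X) (at x y g)
    at-local {y = y} local eq = cong₂ _*_ (cong (λ z → ι (z Fin.≟ y)) (eq (here refl))) (local (eq ∘ there))

    -- The law of total probability for the answer at `x`. Once the answer is fixed, the remaining
    -- tree is the same for all labellings, which is what the induction in `simon-bound` needs.
    split-answer : ∀ {x g} (h : Label → Vec Bool n → Fin N) (f : Label → Fin N → ℕ) →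
      ∑[ j < N ^ N ] (w j * g (h j) * f j (h j x)) ≡
      ∑[ y < N ] ∑[ j < N ^ N ] (w j * at x y g (h j) * f j y)
    split-answer {x} {g} h f = begin
      ∑[ j < N ^ N ] (w j * g (h j) * f j (h j x))
        ≡⟨ sum-cong-≗ (λ j → sum-δ (h j x) (λ y → w j * g (h j) * f j y)) ⟨
      ∑[ j < N ^ N ] ∑[ y < N ] (ι (h j x Fin.≟ y) * (w j * g (h j) * f j y))
        ≡⟨ ∑-comm {N ^ N} {N} _ ⟩
      ∑[ y < N ] ∑[ j < N ^ N ] (ι (h j x Fin.≟ y) * (w j * g (h j) * f j y))
        ≡⟨ sum-cong-≗ (λ y → sum-cong-≗ (λ j → shuffle (ι (h j x Fin.≟ y)) (w j) (g (h j)) (f j y))) ⟩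
      ∑[ y < N ] ∑[ j < N ^ N ] (w j * at x y g (h j) * f j y)   ∎
      where
      open ≡-Reasoning
      shuffle : ∀ a b c d → a * (b * c * d) ≡ b * (a * c) * d
      shuffle = solve-∀

    -- Until a collision occurs, the transcripts are distributed as for the trivial subgroup.
    simon-bound : ∀ t X g → LocalOn X g →
      ∑[ i < N ] (ι (collisionless? (decode i) X) * success t g i) ≤
      ∑[ j < N ^ N ] (w j * g (φ₀ j) * birthday (length X) (queries (φ₀ j) t))
    simon-bound (output z) X g local = begin
      ∑[ i < N ] (ι (collisionless? (decode i) X) * success (output z) g i)   ≤⟨ sum-mono-≤ step ⟩
      ∑[ i < N ] (ι (Q? z i) * C)
        ≡⟨ *-distribʳ-sum C (λ i → ι (Q? z i)) ⟨
      ∑[ i < N ] ι (Q? z i) * C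
        ≤⟨ *-monoˡ-≤ C (sum-ι≤1 (Q? z) (unique z)) ⟩
      1 * C                                                                   ≡⟨ *-identityˡ C ⟩
      C  ≡⟨ sum-cong-≗ (λ j → *-identityʳ (w j * g (φ₀ j))) ⟨
      ∑[ j < N ^ N ] (w j * g (φ₀ j) * 1)   ∎
      where
      open ≤-Reasoning
      C : ℕ
      C = ∑[ j < N ^ N ] (w j * g (φ₀ j))
      step : ∀ i → ι (collisionless? (decode i) X) * success (output z) g i ≤ ι (Q? z i) * C
      step i with collisionless? (decode i) X
      ... | no _     = z≤n
      -- Relabelling makes the weight independent of `i`; what is left is whether `z` is right for
      -- `i`.
      ... | yes free = ≤-reflexive (trans (*-identityˡ (success (output z) g i))
        (trans (sym (*-distribʳ-sum (ι (Q? z i)) (λ j → w j * g (φ (decode i) j))))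
          (trans (*-comm _ (ι (Q? z i))) (cong (ι (Q? z i) *_) (relabel free local)))))
    simon-bound (query x t) X g local = begin
      ∑[ i < N ] (ι (collisionless? (decode i) X) * success (query x t) g i)
        ≤⟨ sum-mono-≤ step ⟩
      ∑[ i < N ] (ι ((x ⊕ decode i) ∈? X) * C +
                  ∑[ y < N ] (ι (collisionless? (decode i) (x ∷ X)) * success (t y) (at x y g) i))
        ≡⟨ ∑-distrib-+ {N} _ _ ⟩
      ∑[ i < N ] (ι ((x ⊕ decode i) ∈? X) * C) +
      ∑[ i < N ] ∑[ y < N ] (ι (collisionless? (decode i) (x ∷ X)) * success (t y) (at x y g) i)
        ≤⟨ +-mono-≤ revealed unrevealed ⟩
      length X * C + rest
        ≡⟨ cong (_+ rest) (trans (*-comm (length X) C) (*-distribʳ-sum (length X) (λ j → w j * g (φ₀ j)))) ⟩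
      ∑[ j < N ^ N ] (w j * g (φ₀ j) * length X) + rest
        ≡⟨ ∑-distrib-+ {N ^ N} _ _ ⟨
      ∑[ j < N ^ N ] (w j * g (φ₀ j) * length X +
                      w j * g (φ₀ j) * birthday (suc (length X)) (queries (φ₀ j) (t (φ₀ j x))))
        ≡⟨ sum-cong-≗ (λ j → *-distribˡ-+ (w j * g (φ₀ j)) (length X) _) ⟨
      ∑[ j < N ^ N ] (w j * g (φ₀ j) * birthday (length X) (queries (φ₀ j) (query x t)))   ∎
      where
      open ≤-Reasoning
      C : ℕ
      C = ∑[ j < N ^ N ] (w j * g (φ₀ j))
      rest : ℕ
      rest = ∑[ j < N ^ N ] (w j * g (φ₀ j) * birthday (suc (length X)) (queries (φ₀ j) (t (φ₀ j x))))
      split : ∀ i → success (query x t) g i ≡ ∑[ y < N ] success (t y) (at x y g) i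
      split i = split-answer {x} {g} (φ (decode i)) (λ j y → ι (Q? (run (φ (decode i) j) (t y)) i))
      step : ∀ i → ι (collisionless? (decode i) X) * success (query x t) g i ≤
        ι ((x ⊕ decode i) ∈? X) * C +
        ∑[ y < N ] (ι (collisionless? (decode i) (x ∷ X)) * success (t y) (at x y g) i)
      step i = cases (collisionless? (decode i) X) ((x ⊕ decode i) ∈? X)
        where
        cases : (free? : Dec (Collisionless (decode i) X)) (hit? : Dec (x ⊕ decode i ∈ˡ X)) →
          ι free? * success (query x t) g i ≤
          ι hit? * C + ∑[ y < N ] (ι (collisionless? (decode i) (x ∷ X)) * success (t y) (at x y g) i)
        cases (no _)     _         = z≤n
        -- The new query collides for this instance, which is conceded at the full weight `C`.
        cases (yes free) (yes _)   = m≤n⇒m≤n+o _ (*-monoʳ-≤ 1 (success-≤ (query x t) local i free))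
        -- Still without a collision, success is split by the answer to `x`.
        cases (yes free) (no miss) = ≤-reflexive (trans (*-identityˡ (success (query x t) g i))
          (trans (split i) (sum-cong-≗ λ y → sym (trans
            (cong (_* success (t y) (at x y g) i)
              (ι-yes (collisionless? (decode i) (x ∷ X)) (collisionless-∷ free miss)))
            (*-identityˡ _)))))
      revealed : ∑[ i < N ] (ι ((x ⊕ decode i) ∈? X) * C) ≤ length X * C
      revealed = ≤-trans (≤-reflexive (sym (*-distribʳ-sum C (λ i → ι ((x ⊕ decode i) ∈? X)))))
        (*-monoˡ-≤ C (count-collisions x X))
      unrevealed : ∑[ i < N ] ∑[ y < N ] (ι (collisionless? (decode i) (x ∷ X)) * success (t y) (at x y g) i) ≤ rest
      unrevealed = begin
        ∑[ i < N ] ∑[ y < N ] (ι (collisionless? (decode i) (x ∷ X)) * success (t y) (at x y g) i)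
          ≡⟨ ∑-comm {N} {N} _ ⟩
        ∑[ y < N ] ∑[ i < N ] (ι (collisionless? (decode i) (x ∷ X)) * success (t y) (at x y g) i)
          ≤⟨ sum-mono-≤ (λ y → simon-bound (t y) (x ∷ X) (at x y g) (at-local {x} {y} {X} {g} local)) ⟩
        ∑[ y < N ] ∑[ j < N ^ N ] (w j * at x y g (φ₀ j) * birthday (suc (length X)) (queries (φ₀ j) (t y)))
          ≡⟨ split-answer {x} {g} φ₀ (λ j y → birthday (suc (length X)) (queries (φ₀ j) (t y))) ⟨
        rest   ∎

-- Simon's problem as a hidden kernel problem

queries-cong : {X Y Z : Set} {φ ψ : X → Y} → φ ≗ ψ → (t : DecisionTree X Y Z) → queries φ t ≡ queries ψ t
queries-cong         φ≗ψ (output z)  = refl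
queries-cong {ψ = ψ} φ≗ψ (query x t) =
  cong suc (trans (queries-cong φ≗ψ (t _)) (cong (λ y → queries ψ (t y)) (φ≗ψ x)))

module Affine {S : Signature} (B : Interpretation S Bool) (B⪯𝖠 : B ⪯ 𝖠) (n : ℕ) where

  open HKP (Power B n)
  open Simon n

  related? : (s x : A) → Dec (rep s ⊥ ≡ rep s x)
  related? s x = rep s ⊥ ≟ᵛ rep s x

  -- Only the class of `⊥` is inspected; it is the hidden subgroup, which determines its generator.
  Identifies : (A → A → Bool) → Pred (Fin N) 0ℓ
  Identifies θ i = ∀ k → θ ⊥ (decode k) ≡ does (related? (decode i) (decode k))

  identifies? : ∀ θ → Decidable (Identifies θ)
  identifies? θ i = Fin.all? λ k → θ ⊥ (decode k) Bool.≟ does (related? (decode i) (decode k))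

  -- The element hidden in `i` is related to `⊥`, so it lies in the subgroup hidden in `j`. Used in
  -- both directions, this gives `unique`.
  identified-either : ∀ θ {i j} → Identifies θ i → Identifies θ j →
               ⊥ ≡ decode {n} i ⊎ decode {n} i ≡ decode j
  identified-either θ {i} {j} p q with related? (decode j) (decode i) | trans (sym (q i)) (p i)
  ... | no _   | eq rewrite dec-true (related? (decode i) (decode i)) (rep-self (decode i)) = contradiction eq λ ()
  ... | yes eq | _  = [ inj₁ , (λ eq′ → inj₂ (trans (sym (⊕-swap eq′)) (⊥-⊕ (decode j)))) ]′
                        (rep-≡ (decode j) ⊥ (decode i) eq)

  unique : ∀ θ {i j} → Identifies θ i → Identifies θ j → i ≡ j
  unique θ {i} {j} p q with identified-either θ {i} {j} p q | identified-either θ {j} {i} q p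
  ... | inj₂ eq | _       = decode-injective {n} eq
  ... | inj₁ _  | inj₂ eq = decode-injective {n} (sym eq)
  ... | inj₁ eq | inj₁ eq′ = decode-injective {n} (trans (sym eq) eq′)

  module Instance {j : Label} (inj : Injective _≡_ _≡_ (label j)) (s : Vec Bool n) where

    ker-φ : ∀ {x y} → φ s j x ≡ φ s j y → rep s x ≡ rep s y
    ker-φ eq = encode-injective (inj eq)

    compatible : ∀ o → Compatible (ker (φ s j)) (lift (B o))
    compatible o xs ys eq = cong (φ₀ j)
      (clone-compatible affine (ker (rep s)) (affine-compatible s) (B⪯𝖠 _ (basic o)) xs ys (ker-φ ∘ eq))

    open Quotient B Fin._≟_ (φ s j) compatible public using (hom)

    kernel-identifies : ∀ {θ} → IsKernel (φ s j) θ → ∀ x → θ ⊥ x ≡ does (related? s x)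
    kernel-identifies isKer x = IsKernel⇒does isKer (related? s x) ker-φ (cong (φ₀ j))

  module _ (M : Algorithm) (solves : Solves M) (q : ℕ) (makes : MakesAtMost M q) where

    R : ℕ
    R = seeds (M (Fin N) Fin._≟_)

    t : Fin R → DecisionTree A (Fin N) (A → A → Bool)
    t = tree (M (Fin N) Fin._≟_)

    correct? : ∀ i j r → Dec (Identifies (run (φ (decode i) j) (t r)) i)
    correct? i j r = identifies? (run (φ (decode i) j) (t r)) i

    χ : Fin N → Fin R → ℕ
    χ i r = success identifies? unique (t r) (const 1) i

    lower : ∀ i → 2 * R * W ≤ 3 * ∑[ r < R ] χ i r
    lower i = begin
      2 * R * W
        ≡⟨ *-distribˡ-sum (2 * R) w ⟩
      ∑[ j < N ^ N ] (2 * R * w j)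
        ≤⟨ sum-mono-≤ (λ j → step j (injective? (label j))) ⟩
      ∑[ j < N ^ N ] (3 * ∑[ r < R ] (w j * 1 * ι (correct? i j r)))
        ≡⟨ *-distribˡ-sum 3 (λ j → ∑[ r < R ] (w j * 1 * ι (correct? i j r))) ⟨
      3 * ∑[ j < N ^ N ] ∑[ r < R ] (w j * 1 * ι (correct? i j r))
        ≡⟨ cong (3 *_) (∑-comm {N ^ N} {R} _) ⟩
      3 * ∑[ r < R ] χ i r   ∎
      where
      open ≤-Reasoning
      step : ∀ j (inj? : Dec (Injective _≡_ _≡_ (label j))) →
             2 * R * ι inj? ≤ 3 * ∑[ r < R ] (ι inj? * 1 * ι (correct? i j r))
      -- A labelling that is not injective has weight zero, so success is demanded of genuine
      -- instances only.
      step j (no _)    = ≤-trans (≤-reflexive (*-zeroʳ (2 * R))) z≤n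
      step j (yes inj) = begin
        2 * R * 1                                       ≡⟨ *-identityʳ (2 * R) ⟩
        2 * R                                           ≤⟨ Prob≥2/3⇒sum-ι (solves _ Fin._≟_ hom)
          (λ isKer k → kernel-identifies isKer (decode k)) (correct? i j) ⟩
        3 * ∑[ r < R ] ι (correct? i j r)
          ≡⟨ cong (3 *_) (sum-cong-≗ (λ r → *-identityˡ (ι (correct? i j r)))) ⟨
        3 * ∑[ r < R ] (1 * 1 * ι (correct? i j r))   ∎
        where open Instance inj (decode i)

    upper : ∀ r → ∑[ i < N ] χ i r ≤ W * (1 + q * q)
    upper r = begin
      ∑[ i < N ] χ i r
        -- Before the first query every shift is collisionless, so the inserted indicator is 1.
        ≡⟨ sum-cong-≗ (λ i → *-identityˡ (χ i r)) ⟨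
      ∑[ i < N ] (ι (collisionless? (decode {n} i) []) * χ i r)
        ≤⟨ simon-bound identifies? unique (t r) [] (const 1) (λ _ → refl) ⟩
      ∑[ j < N ^ N ] (w j * 1 * birthday 0 (queries (φ₀ j) (t r)))
        ≤⟨ sum-mono-≤ (λ j → step j (injective? (label j))) ⟩
      ∑[ j < N ^ N ] (w j * (1 + q * q))
        ≡⟨ *-distribʳ-sum (1 + q * q) w ⟨
      W * (1 + q * q)   ∎
      where
      open ≤-Reasoning
      step : ∀ j (inj? : Dec (Injective _≡_ _≡_ (label j))) →
             ι inj? * 1 * birthday 0 (queries (φ₀ j) (t r)) ≤ ι inj? * (1 + q * q)
      step j (no _)    = z≤n
      step j (yes inj) = *-monoʳ-≤ 1 (≤-trans (birthday-≤ 0 (queries (φ₀ j) (t r))) (s≤s (*-mono-≤ asked asked)))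
        where
        asked : queries (φ₀ j) (t r) ≤ q
        -- The reference oracle is, pointwise, the instance with the trivial subgroup, so the query
        -- bound covers it.
        asked = subst (_≤ q) (queries-cong (cong (φ₀ j) ∘ rep-⊥) (t r)) (makes _ Fin._≟_ hom r)
          where open Instance inj ⊥

    bound : 2 * N ≤ 3 * (1 + q * q)
    bound = *-cancelˡ-≤ W {{W-nonZero}} (begin
      W * (2 * N)              ≡⟨ lhs W N ⟩
      2 * (N * W)
        ≤⟨ averaging {{nonZero (M (Fin N) Fin._≟_)}} W (W * (1 + q * q)) χ lower upper ⟩
      3 * (W * (1 + q * q))    ≡⟨ rhs W q ⟩
      W * (3 * (1 + q * q))    ∎)
      where
      open ≤-Reasoning
      lhs : ∀ W N → W * (2 * N) ≡ 2 * (N * W)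
      lhs = solve-∀
      rhs : ∀ W q → 3 * (W * (1 + q * q)) ≡ W * (3 * (1 + q * q))
      rhs = solve-∀

-- Arithmetic of the bounds and conclusion

2^n≤2*[2^⌊n/2⌋]² : ∀ n → 2 ^ n ≤ 2 * (2 ^ ⌊ n /2⌋ * 2 ^ ⌊ n /2⌋)
2^n≤2*[2^⌊n/2⌋]² 0             = s≤s z≤n
-- The factor 2 pays for rounding down at odd `n`; here it is attained.
2^n≤2*[2^⌊n/2⌋]² 1             = ≤-refl
2^n≤2*[2^⌊n/2⌋]² (suc (suc n)) = ≤-trans (*-monoʳ-≤ 2 (*-monoʳ-≤ 2 (2^n≤2*[2^⌊n/2⌋]² n)))
  (≤-reflexive (lemma (2 ^ ⌊ n /2⌋)))
  where
  lemma : ∀ a → 2 * (2 * (2 * (a * a))) ≡ 2 * ((2 * a) * (2 * a))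
  lemma = solve-∀

-- The assumption on `a` rules out `b` = 0, and a positive `b` absorbs the 1 by doubling.
2*a≤3*[1+b]⇒a≤3*b : ∀ {a b} → 2 ≤ a → 2 * a ≤ 3 * (1 + b) → a ≤ 3 * b
2*a≤3*[1+b]⇒a≤3*b {a} {zero} 2≤a 2a≤3 = contradiction (≤-trans (*-monoʳ-≤ 2 2≤a) 2a≤3) λ { (s≤s (s≤s (s≤s ()))) }
2*a≤3*[1+b]⇒a≤3*b {a} {suc b} 2≤a le = *-cancelˡ-≤ 2 (≤-trans le (begin
  3 * (1 + suc b)        ≤⟨ *-monoʳ-≤ 3 (+-monoˡ-≤ (suc b) (s≤s z≤n)) ⟩
  3 * (suc b + suc b)    ≡⟨ lemma b ⟩
  2 * (3 * suc b)        ∎))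
  where
  open ≤-Reasoning
  lemma : ∀ b → 3 * (suc b + suc b) ≡ 2 * (3 * suc b)
  lemma = solve-∀

∁-involutive : (x : Subset n) → ∁ (∁ x) ≡ x
∁-involutive []      = refl
∁-involutive (a ∷ x) = cong₂ _∷_ (Bool.not-involutive a) (∁-involutive x)

∁-∪ : (x y : Subset n) → ∁ (x ∪ y) ≡ ∁ x ∩ ∁ y
∁-∪ []          []      = refl
∁-∪ (false ∷ x) (b ∷ y) = cong (not b ∷_) (∁-∪ x y)
∁-∪ (true ∷ x)  (b ∷ y) = cong (false ∷_) (∁-∪ x y)

search⇒2^n≤ : ∀ n q → 2 ≤ n → 2 * (2 ^ ⌊ n /2⌋ * 1) ≤ 3 * (1 + q) → 2 ^ n ≤ (5 * q) ^ 2
search⇒2^n≤ n q 2≤n le = begin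
  2 ^ n                                  ≤⟨ 2^n≤2*[2^⌊n/2⌋]² n ⟩
  2 * (2 ^ ⌊ n /2⌋ * 2 ^ ⌊ n /2⌋)        ≤⟨ *-monoʳ-≤ 2 (*-mono-≤ I≤3q I≤3q) ⟩
  -- This is 18 q², and 5 is the least integer whose square is at least 18.
  2 * (3 * q * (3 * q))                  ≤⟨ m≤m+n _ (7 * (q * q)) ⟩
  2 * (3 * q * (3 * q)) + 7 * (q * q)    ≡⟨ lemma q ⟩
  (5 * q) ^ 2   ∎
  where
  open ≤-Reasoning
  I≤3q : 2 ^ ⌊ n /2⌋ ≤ 3 * q
  I≤3q = 2*a≤3*[1+b]⇒a≤3*b (^-monoʳ-≤ 2 (⌊n/2⌋-mono 2≤n))
    (subst (λ a → 2 * a ≤ 3 * (1 + q)) (*-identityʳ (2 ^ ⌊ n /2⌋)) le)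
  lemma : ∀ q → 2 * (3 * q * (3 * q)) + 7 * (q * q) ≡ (5 * q) * ((5 * q) * 1)
  lemma = solve-∀

simon⇒2^n≤ : ∀ n q → 2 ≤ n → 2 * 2 ^ n ≤ 3 * (1 + q * q) → 2 ^ n ≤ (5 * q) ^ 2
simon⇒2^n≤ n q 2≤n le = begin
  2 ^ n                          ≤⟨ 2*a≤3*[1+b]⇒a≤3*b (^-monoʳ-≤ 2 (<⇒≤ 2≤n)) le ⟩
  3 * (q * q)                    ≤⟨ m≤m+n _ (22 * (q * q)) ⟩
  3 * (q * q) + 22 * (q * q)     ≡⟨ lemma q ⟩
  (5 * q) ^ 2   ∎
  where
  open ≤-Reasoning
  lemma : ∀ q → 3 * (q * q) + 22 * (q * q) ≡ (5 * q) * ((5 * q) * 1)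
  lemma = solve-∀

theorem5p1 : (S : Signature) (B : Interpretation S Bool) →
    (B ⪯ ⋀) ⊎ (B ⪯ ⋁) ⊎ (B ⪯ 𝖠) →
    ∃[ K ] ∃[ N ] ∀ (n : ℕ) → N ≤ n →
    (M : HKP.Algorithm (Power B n)) → HKP.Solves (Power B n) M →
    (q : ℕ) → HKP.MakesAtMost (Power B n) M q →
    2 ^ n ≤ (K * q) ^ 2
-- The search cases dictate the constant 5. From `n` = 2 on, ⌊n/2⌋ is positive, so there are at
-- least two candidates to search. The squared conclusion expresses q ≥ 2^(n/2) / 5 in natural
-- numbers.
theorem5p1 S B B⪯ = 5 , 2 , λ n 2≤n M solves q makes → cases n 2≤n M solves q makes B⪯
  where
  cases : ∀ n → 2 ≤ n → (M : HKP.Algorithm (Power B n)) → HKP.Solves (Power B n) M →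
          ∀ q → HKP.MakesAtMost (Power B n) M q → (B ⪯ ⋀) ⊎ (B ⪯ ⋁) ⊎ (B ⪯ 𝖠) → 2 ^ n ≤ (5 * q) ^ 2
  cases n 2≤n M solves q makes (inj₁ B⪯⋀) = search⇒2^n≤ n q 2≤n
    (Semilattice.bound B _∧_ B⪯⋀ id (λ _ → refl) (λ _ _ → refl) (⌊n/2⌋-mono 2≤n) M solves q makes)
  cases n 2≤n M solves q makes (inj₂ (inj₁ B⪯⋁)) = search⇒2^n≤ n q 2≤n
    (Semilattice.bound B _∨_ B⪯⋁ ∁ ∁-involutive ∁-∪ (⌊n/2⌋-mono 2≤n) M solves q makes)
  cases n 2≤n M solves q makes (inj₂ (inj₂ B⪯𝖠)) = simon⇒2^n≤ n q 2≤n
    (Affine.bound B B⪯𝖠 n M solves q makes)
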